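{- For all non-negative integers $k$ and $l$, there exists a number $S$ such that for any collection of (distinct) sets $\mathcal{H}$, $|\mathcal{H}|>S$ implies that at least one of the following three propositions holds: (1) The $(k+1)$-singleton matrix can be found in $\mathcal{H}$. (2) The $(l+1)$-cosingleton matrix can be found in $\mathcal{H}$. (3) The $\min(k+1,l+1)$-monotone matrix can be found in $\mathcal{H}$. Moreover, denoting by $S(k,l)$ the smallest non-negative integer $S$ with this property, we have $$S(k,l)=S(l,k)\leq \binom{R(k+1)+R(l+1)-2}{R(k+1)-1}.$$
   Context: A 0-1 matrix $N$ with $a$ rows and $b$ columns can be found in a collection of sets $\mathcal{H}$ if there are distinct sets $H_1,\dots,H_a\in\mathcal{H}$ and distinct elements $e_1,\dots,e_b\in\bigcup_{H\in\mathcal{H}}H$ such that $N_{\alpha,\beta}=1$ if and only if $e_\beta\in H_\alpha$. For an integer $n\ge 1$, the following matrices have $n+1$ rows and $n$ columns with entries in $\{0,1\}$: the $n$-singleton matrix $S^n$, with $S^n_{i,j}=1$ iff $i=j+1$; the $n$-cosingleton matrix $\bar S^n$, with $\bar S^n_{i,j}=0$ iff $i=j$; the $n$-monotone matrix $M^n$, with $M^n_{i,j}=1$ iff $i\ge j+1$. For a positive integer $r$, $R(r)$ denotes the Ramsey number: the smallest positive integer $n$ such that for every partition $(A_0,A_1)$ of the set $\binom{[n]}{2}$ of 2-element subsets of $[n]=\{1,\dots,n\}$ there is $A'\subseteq[n]$ with $|A'|\ge r$ and either $\binom{A'}{2}\subseteq A_0$ or $\binom{A'}{2}\subseteq A_1$.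 -}

module Defs where

open import Data.Bool.Base using (Bool; true; false; not)
import Data.Bool.Properties as Bool
open import Data.Fin.Base using (Fin; zero; suc; toℕ; combine; remQuot; _<_)
open import Data.Fin.Properties as Fin using (remQuot-combine)
open import Data.Fin.Subset using (Subset; inside; outside; _∈_; _⊆_; ∣_∣; ⊤; ⊥; _∩_; ∁)
open import Data.Fin.Subset.Properties
  using (_∈?_; anySubset?; ∉⊥; ∣⊤∣≡n; x∈p∩q⁻; x∈∁p⇒x∉p)
open import Data.Nat.Base as ℕ using (ℕ; zero; suc; _+_; _⊓_; _≤_; z≤n; s≤s)
open import Data.Nat.Induction using (<-rec)
import Data.Nat.Properties as ℕ
open import Data.Product.Base using (∃-syntax; _×_; _,_; proj₁; proj₂; uncurry)
open import Data.Sum.Base as Sum using (_⊎_; inj₁; inj₂; [_,_]′)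
open import Data.Vec.Base using (_∷_; []; here; there; lookup; tabulate)
open import Data.Vec.Properties using ([]=⇒lookup; lookup⇒[]=; lookup∘tabulate)
open import Function.Bundles using (_⇔_)
open import Function.Definitions using (Injective)
open import Level using (Level) renaming (suc to lsuc)
open import Relation.Binary.PropositionalEquality
open import Relation.Nullary.Decidable as Dec
  using (Dec; yes; no; ⌊_⌋; ¬?; decidable-stable; _×-dec_; _⊎-dec_; _→-dec_)
open import Relation.Nullary.Negation using (contradiction)
open import Relation.Unary as Unary using (Pred; Decidable; _≐_)

private
  variable
    a ℓ : Level
    m n : ℕ

IsLeast : Pred ℕ ℓ → ℕ → Set ℓ
IsLeast P n = P n × (∀ m → P m → n ≤ m)

Matrix : ℕ → ℕ → Set
Matrix m n = Fin m → Fin n → Bool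

-- Rows and columns are numbered from 0 instead of 1; the relations
-- between i and j below are not affected by shifting both by one.

singleton : ∀ n → Matrix (suc n) n
singleton n i j = ⌊ toℕ i ℕ.≟ suc (toℕ j) ⌋

cosingleton : ∀ n → Matrix (suc n) n
cosingleton n i j = not ⌊ toℕ i ℕ.≟ toℕ j ⌋

monotone : ∀ n → Matrix (suc n) n
monotone n i j = ⌊ suc (toℕ j) ℕ.≤? toℕ i ⌋

-- Sets are compared extensionally, by _≐_, throughout: a collection is
-- a possibly infinite predicate on subsets of U, and sets are distinct
-- when they do not have the same elements.

Collection : Set a → Set (lsuc a)
Collection {a} U = Pred (Pred U a) a

Union : {U : Set a} → Collection U → Pred U (lsuc a)
Union ℋ e = ∃[ H ] (H Unary.∈ ℋ × e Unary.∈ H)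

DistinctMembers : {U : Set a} → Collection U → ∀ n → (Fin n → Pred U a) → Set a
DistinctMembers ℋ n H = (∀ i → H i Unary.∈ ℋ) × Injective _≡_ _≐_ H

-- ∣ ℋ ∣ > s, for ℋ finite or infinite: s + 1 members can be chosen.

MoreThan : {U : Set a} → Collection U → ℕ → Set (lsuc a)
MoreThan ℋ s = ∃[ H ] DistinctMembers ℋ (suc s) H

FoundIn : {U : Set a} → Matrix m n → Collection U → Set (lsuc a)
FoundIn {m = m} {n = n} {U = U} N ℋ =
  ∃[ H ] ∃[ e ]
    DistinctMembers ℋ m H ×
    Injective {A = Fin n} {B = U} _≡_ _≡_ e ×
    (∀ β → e β Unary.∈ Union ℋ) ×
    (∀ α β → N α β ≡ true ⇔ e β Unary.∈ H α)

Forces : ∀ a → ℕ → ℕ → ℕ → Set (lsuc a)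
Forces a k l s =
  (U : Set a) (ℋ : Collection U) → MoreThan ℋ s →
  FoundIn (singleton (suc k)) ℋ ⊎
  FoundIn (cosingleton (suc l)) ℋ ⊎
  FoundIn (monotone (suc k ⊓ suc l)) ℋ

-- The 2-element subset {i, j} with i < j is coloured by c i j; the
-- values of c at other pairs play no role.

Colouring : ℕ → Set
Colouring n = Fin n → Fin n → Bool

Monochromatic : Colouring n → Bool → Subset n → Set
Monochromatic c b A = ∀ i j → i ∈ A → j ∈ A → i < j → c i j ≡ b

Homogeneous : Colouring n → ℕ → Subset n → Set
Homogeneous c r A = r ≤ ∣ A ∣ × (Monochromatic c false A ⊎ Monochromatic c true A)

IsRamsey : ℕ → ℕ → Set
IsRamsey r n = 1 ≤ n × (∀ (c : Colouring n) → ∃[ A ] Homogeneous c r A)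

private

  least : {P : Pred ℕ ℓ} → Decidable P → ∀ n → P n → ∃[ n ] IsLeast P n
  least {P = P} P? = <-rec (λ n → P n → ∃[ n ] IsLeast P n) step
    where
    step : ∀ n → (∀ {m} → m ℕ.< n → P m → ∃[ n ] IsLeast P n) → P n → ∃[ n ] IsLeast P n
    step n rec Pn with ℕ.anyUpTo? P? n
    ... | yes (m , m<n , Pm) = rec m<n Pm
    ... | no ∄m<n = n , Pn , λ m Pm → ℕ.≮⇒≥ λ m<n → ∄m<n (m , m<n , Pm)

  homogeneous? : ∀ (c : Colouring n) r → Decidable (Homogeneous c r)
  homogeneous? c r A = r ℕ.≤? ∣ A ∣ ×-dec (mono? false ⊎-dec mono? true)
    where
    mono? : ∀ b → Dec (Monochromatic c b A)
    mono? b = Fin.all? λ i → Fin.all? λ j →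
      i ∈? A →-dec (j ∈? A →-dec (i Fin.<? j →-dec c i j Bool.≟ b))

  Homogeneous-transport : ∀ {c d : Colouring n} {r A} → (∀ i j → c i j ≡ d i j) →
                     Homogeneous c r A → Homogeneous d r A
  Homogeneous-transport {c = c} {d} {A = A} c≗d (r≤ , mono) = r≤ , Sum.map transport transport mono
    where
    transport : ∀ {b} → Monochromatic c b A → Monochromatic d b A
    transport mc i j i∈A j∈A i<j = trans (sym (c≗d i j)) (mc i j i∈A j∈A i<j)

  -- A subset of Fin (n * n) encodes a colouring.

  decode : Subset (n ℕ.* n) → Colouring n
  decode s i j = lookup s (combine i j)

  encode : Colouring n → Subset (n ℕ.* n)
  encode {n} c = tabulate λ x → uncurry c (remQuot n x)

  decode-encode : ∀ (c : Colouring n) i j → decode (encode c) i j ≡ c i j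
  decode-encode {n} c i j =
    trans (lookup∘tabulate _ (combine i j)) (cong (uncurry c) (remQuot-combine {n} {n} i j))

  isRamsey? : ∀ r → Decidable (IsRamsey r)
  isRamsey? r n = 1 ℕ.≤? n ×-dec
    Dec.map′ (λ ∄s c → decidable-stable (found? c) λ ∄A →
                ∄s (encode c , λ (A , h) → ∄A (A , Homogeneous-transport {c = decode (encode c)} (decode-encode c) h)))
             (λ all (s , ∄A) → ∄A (all (decode s)))
             (¬? (anySubset? λ s → ¬? (found? (decode s))))
    where
    found? : ∀ (c : Colouring n) → Dec (∃[ A ] Homogeneous c r A)
    found? c = anySubset? (homogeneous? c r)

  bound : ℕ → ℕ → ℕ
  bound zero    t       = 1
  bound (suc s) zero    = 1
  bound (suc s) (suc t) = suc (bound s (suc t) + bound (suc s) t)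

  bound-positive : ∀ s t → 1 ≤ bound s t
  bound-positive zero    t       = s≤s z≤n
  bound-positive (suc s) zero    = s≤s z≤n
  bound-positive (suc s) (suc t) = s≤s z≤n

  ∣p∩q∣+∣p∩∁q∣≡∣p∣ : ∀ (p q : Subset n) → ∣ p ∩ q ∣ + ∣ p ∩ ∁ q ∣ ≡ ∣ p ∣
  ∣p∩q∣+∣p∩∁q∣≡∣p∣ []            []            = refl
  ∣p∩q∣+∣p∩∁q∣≡∣p∣ (outside ∷ p) (y ∷ q)       = ∣p∩q∣+∣p∩∁q∣≡∣p∣ p q
  ∣p∩q∣+∣p∩∁q∣≡∣p∣ (inside ∷ p)  (inside ∷ q)  = cong suc (∣p∩q∣+∣p∩∁q∣≡∣p∣ p q)
  ∣p∩q∣+∣p∩∁q∣≡∣p∣ (inside ∷ p)  (outside ∷ q) =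
    trans (ℕ.+-suc _ _) (cong suc (∣p∩q∣+∣p∩∁q∣≡∣p∣ p q))

  split≤ : ∀ {x y z w} → x + y ≤ z + w → x ≤ z ⊎ y ≤ w
  split≤ {x} {y} {z} {w} p with x ℕ.≤? z
  ... | yes x≤z = inj₁ x≤z
  ... | no  x≰z = inj₂ (ℕ.≮⇒≥ λ w<y → ℕ.<⇒≱ (ℕ.+-mono-< (ℕ.≰⇒> x≰z) w<y) p)

  Clique : Colouring n → Bool → ℕ → Subset n → Set
  Clique c b s V = ∃[ A ] (A ⊆ V × s ≤ ∣ A ∣ × Monochromatic c b A)

  empty : ∀ (c : Colouring n) b V → Clique c b 0 V
  empty c b V = ⊥ , (λ x∈⊥ → contradiction x∈⊥ ∉⊥) , z≤n ,
                λ i j i∈⊥ → contradiction i∈⊥ ∉⊥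

  tail : Colouring (suc n) → Colouring n
  tail c i j = c (suc i) (suc j)

  skip : ∀ (c : Colouring (suc n)) {b s V W x} → V ⊆ W →
         Clique (tail c) b s V → Clique c b s (x ∷ W)
  skip c {b} {V = V} {W} {x} V⊆W (A , A⊆V , s≤ , mono) = outside ∷ A , sub , s≤ , mono′
    where
    sub : outside ∷ A ⊆ x ∷ W
    sub (there i∈A) = there (V⊆W (A⊆V i∈A))
    mono′ : Monochromatic c b (outside ∷ A)
    mono′ (suc i) (suc j) (there i∈A) (there j∈A) (s≤s i<j) = mono i j i∈A j∈A i<j

  extend : ∀ (c : Colouring (suc n)) {b s V W} → V ⊆ W → (∀ i → i ∈ V → c zero (suc i) ≡ b) →
           Clique (tail c) b s V → Clique c b (suc s) (inside ∷ W)
  extend c {b} {V = V} {W} V⊆W c0 (A , A⊆V , s≤ , mono) = inside ∷ A , sub , s≤s s≤ , mono′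
    where
    sub : inside ∷ A ⊆ inside ∷ W
    sub here        = here
    sub (there i∈A) = there (V⊆W (A⊆V i∈A))
    mono′ : Monochromatic c b (inside ∷ A)
    mono′ zero    (suc j) _           (there j∈A) _         = c0 j (A⊆V j∈A)
    mono′ (suc i) (suc j) (there i∈A) (there j∈A) (s≤s i<j) = mono i j i∈A j∈A i<j

  clique : ∀ (c : Colouring n) s t V → bound s t ≤ ∣ V ∣ → Clique c true s V ⊎ Clique c false t V
  clique c zero    t       V  _ = inj₁ (empty c true V)
  clique c (suc s) zero    V  _ = inj₂ (empty c false V)
  clique c (suc s) (suc t) [] ()
  clique c (suc s) (suc t) (outside ∷ V) b≤ =
    Sum.map (skip c (λ x∈V → x∈V)) (skip c (λ x∈V → x∈V)) (clique (tail c) (suc s) (suc t) V b≤)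
  clique {suc n} c (suc s) (suc t) (inside ∷ V) (s≤s b≤) =
    [ (λ p → Sum.map (extend c V₁⊆V V₁-true) (skip c V₁⊆V) (clique (tail c) s (suc t) (V ∩ N) p))
    , (λ p → Sum.map (skip c V₀⊆V) (extend c V₀⊆V V₀-false) (clique (tail c) (suc s) t (V ∩ ∁ N) p))
    ]′ (split≤ (ℕ.≤-trans b≤ (ℕ.≤-reflexive (sym (∣p∩q∣+∣p∩∁q∣≡∣p∣ V N)))))
    where
    N : Subset n
    N = tabulate λ i → c zero (suc i)
    V₁⊆V : V ∩ N ⊆ V
    V₁⊆V x∈ = proj₁ (x∈p∩q⁻ V N x∈)
    V₀⊆V : V ∩ ∁ N ⊆ V
    V₀⊆V x∈ = proj₁ (x∈p∩q⁻ V (∁ N) x∈)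
    V₁-true : ∀ i → i ∈ V ∩ N → c zero (suc i) ≡ true
    V₁-true i i∈ = trans (sym (lookup∘tabulate _ i)) ([]=⇒lookup (proj₂ (x∈p∩q⁻ V N i∈)))
    V₀-false : ∀ i → i ∈ V ∩ ∁ N → c zero (suc i) ≡ false
    V₀-false i i∈ = Bool.¬-not λ eq →
      x∈∁p⇒x∉p (proj₂ (x∈p∩q⁻ V (∁ N) i∈)) (lookup⇒[]= i N (trans (lookup∘tabulate _ i) eq))

  bound-isRamsey : ∀ r → IsRamsey r (bound r r)
  bound-isRamsey r = bound-positive r r , λ c →
    [ (λ (A , _ , r≤ , mono) → A , r≤ , inj₂ mono)
    , (λ (A , _ , r≤ , mono) → A , r≤ , inj₁ mono)
    ]′ (clique c r r ⊤ (ℕ.≤-reflexive (sym (∣⊤∣≡n (bound r r)))))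

abstract
  ramsey : ∀ r → ∃[ n ] IsLeast (IsRamsey r) n
  ramsey r = least (isRamsey? r) (bound r r) (bound-isRamsey r)

R : ℕ → ℕ
R r = proj₁ (ramsey r)

{-# OPTIONS --safe #-}
module Submission where

-- Repeatedly pick an element that splits the current family of sets, put
-- aside one set from one part and continue in the other.
-- Pascal's rule bounds how long this can avoid p + 1 set-asides containing
-- their element (absent from all later sets) and q + 1 avoiding it (present
-- in all later sets).  In either kind of staircase only the incidences of an
-- earlier set with a later element are free; Ramsey's theorem makes them
-- constant, which leaves a (co)singleton or a monotone matrix.  Passing to
-- complements exchanges the two kinds and gives S(k,l) = S(l,k).

open import Defs
open import Axiom.ExcludedMiddle using (ExcludedMiddle)
open import Data.Bool.Base using (Bool; true; false; not)
open import Data.Bool.Properties as Bool using (not-involutive; not-injective; not-¬; ⇔→≡)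
open import Data.Fin.Base as Fin using (Fin; zero; suc; toℕ; fromℕ; inject₁; inject≤; opposite)
import Data.Fin.Properties as Fin
open import Data.Fin.Relation.Unary.Top using (view; view-inject₁; ‵fromℕ; ‵inject₁)
open import Data.Fin.Subset as Subset using (Subset; inside; outside; ∣_∣)
open import Data.List.Base using (List; []; _∷_; length; filter; allFin; [_])
open import Data.List.Membership.Propositional using (_∈_)
open import Data.List.Membership.Propositional.Properties using (∈-filter⁻)
open import Data.List.Properties using (length-tabulate)
open import Data.List.Relation.Unary.All as All using ()
open import Data.List.Relation.Unary.AllPairs using (_∷_)
open import Data.List.Relation.Unary.Any using (here; there)
open import Data.List.Relation.Unary.Unique.Propositional using (Unique)
open import Data.List.Relation.Unary.Unique.Propositional.Properties using (allFin⁺; filter⁺)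
open import Data.Nat.Base using (ℕ; zero; suc; _+_; _∸_; _⊓_; _≤_; _<_; z≤n; s≤s; s≤s⁻¹)
open import Data.Nat.Combinatorics using (_C_; nCk≡nC[n∸k]; nCn≡1; nCk+nC[k+1]≡[n+1]C[k+1])
open import Data.Nat.Induction using (<-rec)
import Data.Nat.Properties as ℕ
open import Data.Product.Base using (Σ-syntax; ∃-syntax; _×_; _,_; proj₁; proj₂)
open import Data.Sum.Base as Sum using (_⊎_; inj₁; inj₂; [_,_]′)
open import Data.Vec.Base using (here; there) renaming (_∷_ to _∷ᵛ_)
import Data.Vec.Functional as Vector
open import Function.Base using (_∘_)
open import Function.Bundles using (_⇔_; mk⇔; Equivalence)
open import Function.Definitions using (Injective)
open import Level using (Level; 0ℓ; Lift; lift; lower) renaming (suc to lsuc)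
open import Relation.Binary.Definitions using (tri<; tri≈; tri>)
open import Relation.Binary.PropositionalEquality
  using (_≡_; _≢_; refl; sym; trans; cong; subst; subst₂)
open import Relation.Nullary.Decidable
  using (Dec; yes; no; ⌊_⌋; map′; decidable-stable; isYes≗does; does-⇔; dec-true; dec-false)
open import Relation.Nullary.Negation using (¬_; contradiction)
open import Relation.Unary using (Pred; _≐_)
open import Relation.Unary.Properties using (≐-refl)

-- Boolean incidences and the matrices occurring in them.

private
  variable
    a b ℓ : Level
    m n r : ℕ
    X : Set a
    U : Set b

Incidence : Set a → Set ℓ → Set _
Incidence X U = X → U → Bool

complement : Incidence X U → Incidence X U
complement h x u = not (h x u)

Separated : Incidence X U → Set _
Separated h = ∀ x y → x ≢ y → ∃[ u ] h x u ≢ h y u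

Occurs : Matrix m n → Incidence X U → Set _
Occurs {m = m} {n = n} {X = X} {U = U} N h =
  Σ[ x ∈ (Fin m → X) ] Σ[ u ∈ (Fin n → U) ] (∀ i j → h (x i) (u j) ≡ N i j)

-- Entries of the three matrices, and triangular matrices.

⌊⌋-true : {P : Set ℓ} (P? : Dec P) → P → ⌊ P? ⌋ ≡ true
⌊⌋-true P? p = trans (isYes≗does P?) (dec-true P? p)

⌊⌋-false : {P : Set ℓ} (P? : Dec P) → ¬ P → ⌊ P? ⌋ ≡ false
⌊⌋-false P? ¬p = trans (isYes≗does P?) (dec-false P? ¬p)

⌊⌋-⇔ : ∀ {p q} {P : Set p} {Q : Set q} (P? : Dec P) (Q? : Dec Q) → P ⇔ Q → ⌊ P? ⌋ ≡ ⌊ Q? ⌋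
⌊⌋-⇔ P? Q? P⇔Q = trans (isYes≗does P?) (trans (does-⇔ P⇔Q P? Q?) (sym (isYes≗does Q?)))

⌊⌋≡true⇒ : {P : Set ℓ} (P? : Dec P) → ⌊ P? ⌋ ≡ true → P
⌊⌋≡true⇒ (yes p) _ = p

-- A common description of two of the matrices: `d` is `true` for `cosingleton` and `false` for
-- `monotone`. The last row lies wholly below the diagonal, hence `inject₁` for the others.
record Triangular (d : Bool) (N : Matrix (suc n) n) : Set where
  field
    diagonal : ∀ i → N (inject₁ i) i ≡ false
    below    : ∀ i j → toℕ j < toℕ i → N i j ≡ true
    above    : ∀ i j → toℕ i < toℕ j → N (inject₁ i) j ≡ d

open Triangular

triangular-unique : ∀ {d} {M N : Matrix (suc n) n} →
                    Triangular d M → Triangular d N → ∀ i j → M i j ≡ N i j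
triangular-unique {n} tM tN i j with view i
... | ‵fromℕ = trans (below tM _ j j<n) (sym (below tN _ j j<n))
  where
  j<n : toℕ j < toℕ (fromℕ n)
  j<n = subst (toℕ j <_) (sym (Fin.toℕ-fromℕ n)) (Fin.toℕ<n j)
... | ‵inject₁ i′ with Fin.<-cmp i′ j
...   | tri< i<j _ _  = trans (above tM i′ j i<j) (sym (above tN i′ j i<j))
...   | tri≈ _ refl _ = trans (diagonal tM j) (sym (diagonal tN j))
...   | tri> _ _ j<i  = trans (below tM _ j j<i′) (sym (below tN _ j j<i′))
  where
  j<i′ : toℕ j < toℕ (inject₁ i′)
  j<i′ = subst (toℕ j <_) (sym (Fin.toℕ-inject₁ i′)) j<i

cosingleton-triangular : ∀ n → Triangular true (cosingleton n)
cosingleton-triangular n .diagonal i   = cong not (⌊⌋-true (_ ℕ.≟ _) (Fin.toℕ-inject₁ i))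
cosingleton-triangular n .below i j lt = cong not (⌊⌋-false (_ ℕ.≟ _) (ℕ.<⇒≢ lt ∘ sym))
cosingleton-triangular n .above i j lt = cong not (⌊⌋-false (_ ℕ.≟ _) λ eq →
  ℕ.<⇒≢ lt (trans (sym (Fin.toℕ-inject₁ i)) eq))

monotone-triangular : ∀ n → Triangular false (monotone n)
monotone-triangular n .diagonal i   = ⌊⌋-false (_ ℕ.≤? _) λ lt →
  ℕ.<-irrefl (sym (Fin.toℕ-inject₁ i)) lt
monotone-triangular n .below i j lt = ⌊⌋-true (_ ℕ.≤? _) lt
monotone-triangular n .above i j lt = ⌊⌋-false (_ ℕ.≤? _) λ lt′ →
  ℕ.<-asym lt (subst (toℕ j <_) (Fin.toℕ-inject₁ i) lt′)

-- A matrix that is Discerning can only occur with distinct sets, distinct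
-- elements, and elements in the union, so that these need no checking.

record Discerning (N : Matrix m n) : Set where
  field
    row-injective    : ∀ {i j} → (∀ k → N i k ≡ N j k) → i ≡ j
    column-injective : ∀ {i j} → (∀ k → N k i ≡ N k j) → i ≡ j
    column-nonzero   : ∀ j → ∃[ i ] N i j ≡ true

open Discerning

-- Rows `i < j` differ in column `i`, and columns `i < j` differ in row `j`: in both cases a
-- `diagonal` entry meets a `below` entry. The last row is nonzero everywhere.
triangular⇒discerning : ∀ {d} {N : Matrix (suc n) n} → Triangular d N → Discerning N
triangular⇒discerning {n} {N = N} t = record
  { row-injective    = rows
  ; column-injective = columns
  ; column-nonzero   = λ j →
      fromℕ n , below t _ j (subst (toℕ j <_) (sym (Fin.toℕ-fromℕ n)) (Fin.toℕ<n j))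
  }
  where
  row< : ∀ i j → toℕ i < toℕ j → ¬ (∀ k → N i k ≡ N j k)
  row< i j i<j eq with view i
  ... | ‵fromℕ = ℕ.<⇒≱ i<j (Fin.≤fromℕ j)
  ... | ‵inject₁ i′ = not-¬ (diagonal t i′) (trans (eq i′)
          (below t j i′ (subst (_< toℕ j) (Fin.toℕ-inject₁ i′) i<j)))
  rows : ∀ {i j} → (∀ k → N i k ≡ N j k) → i ≡ j
  rows {i} {j} eq with Fin.<-cmp i j
  ... | tri< i<j _ _ = contradiction eq (row< i j i<j)
  ... | tri≈ _ i≡j _ = i≡j
  ... | tri> _ _ j<i = contradiction (sym ∘ eq) (row< j i j<i)
  column< : ∀ i j → toℕ i < toℕ j → ¬ (∀ k → N k i ≡ N k j)
  column< i j i<j eq = not-¬ (diagonal t j) (trans (sym (eq (inject₁ j)))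
    (below t (inject₁ j) i (subst (toℕ i <_) (sym (Fin.toℕ-inject₁ j)) i<j)))
  columns : ∀ {i j} → (∀ k → N k i ≡ N k j) → i ≡ j
  columns {i} {j} eq with Fin.<-cmp i j
  ... | tri< i<j _ _ = contradiction eq (column< i j i<j)
  ... | tri≈ _ i≡j _ = i≡j
  ... | tri> _ _ j<i = contradiction (sym ∘ eq) (column< j i j<i)

singleton-discerning : ∀ n → Discerning (singleton n)
singleton-discerning n = record
  { row-injective    = rows
  ; column-injective = λ {i} {j} eq → Fin.toℕ-injective (ℕ.suc-injective
      (⌊⌋≡true⇒ (_ ℕ.≟ _) (trans (sym (eq (suc i))) (one i))))
  ; column-nonzero   = λ j → suc j , one j
  }
  where
  one : ∀ j → singleton n (suc j) j ≡ true
  one j = ⌊⌋-true (_ ℕ.≟ _) refl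
  rows : ∀ {i j} → (∀ k → singleton n i k ≡ singleton n j k) → i ≡ j
  rows {zero}  {zero}  eq = refl
  rows {suc i} {j}     eq = Fin.toℕ-injective (sym (⌊⌋≡true⇒ (_ ℕ.≟ _) (trans (sym (eq i)) (one i))))
  rows {zero}  {suc j} eq = Fin.toℕ-injective (⌊⌋≡true⇒ (_ ℕ.≟ _) (trans (eq j) (one j)))

-- Complements and corners of the matrices.

occurs-complement : ∀ {M N : Matrix m n} (h : Incidence X U)
                    (ρ : Fin m → Fin m) (γ : Fin n → Fin n) →
                    (∀ i j → N (ρ i) (γ j) ≡ not (M i j)) → Occurs N (complement h) → Occurs M h
occurs-complement h ρ γ eq (x , u , occ) = x ∘ ρ , u ∘ γ , λ i j →
  not-injective (trans (occ (ρ i) (γ j)) (eq i j))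

-- The complement of `singleton` is `cosingleton` up to a cyclic shift of rows: the zero row, which
-- is first, turns into the full row, which `cosingleton` has last.
singleton-complement : ∀ (h : Incidence X U) n →
                       Occurs (singleton n) (complement h) → Occurs (cosingleton n) h
singleton-complement h n = occurs-complement h ρ (λ j → j) eq
  where
  ρ : Fin (suc n) → Fin (suc n)
  ρ i with view i
  ... | ‵fromℕ      = zero
  ... | ‵inject₁ i′ = suc i′
  eq : ∀ i j → singleton n (ρ i) j ≡ not (cosingleton n i j)
  eq i j with view i
  ... | ‵fromℕ = sym (trans (not-involutive _) (⌊⌋-false (_ ℕ.≟ _)
          (ℕ.<⇒≢ (Fin.toℕ<n j) ∘ sym ∘ trans (sym (Fin.toℕ-fromℕ n)))))
  ... | ‵inject₁ i′ = sym (trans (not-involutive _) (⌊⌋-⇔ (_ ℕ.≟ _) (_ ℕ.≟ _) (mk⇔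
          (cong suc ∘ trans (sym (Fin.toℕ-inject₁ i′)))
          (trans (Fin.toℕ-inject₁ i′) ∘ ℕ.suc-injective))))

cosingleton-complement : ∀ (h : Incidence X U) n →
                         Occurs (cosingleton n) (complement h) → Occurs (singleton n) h
cosingleton-complement h n = occurs-complement h ρ (λ j → j) (λ i j → cong not (eq i j))
  where
  ρ : Fin (suc n) → Fin (suc n)
  ρ zero    = fromℕ n
  ρ (suc i) = inject₁ i
  eq : ∀ i j → ⌊ toℕ (ρ i) ℕ.≟ toℕ j ⌋ ≡ singleton n i j
  eq zero    j = ⌊⌋-false (_ ℕ.≟ _) (ℕ.<⇒≢ (Fin.toℕ<n j) ∘ sym ∘ trans (sym (Fin.toℕ-fromℕ n)))
  eq (suc i) j = ⌊⌋-⇔ (_ ℕ.≟ _) (_ ℕ.≟ _) (mk⇔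
    (cong suc ∘ trans (sym (Fin.toℕ-inject₁ i)))
    (trans (Fin.toℕ-inject₁ i) ∘ ℕ.suc-injective))

-- Complementing replaces `j < i` by `i ≤ j`; reversing the order of both rows and columns restores
-- the original shape.
monotone-complement : ∀ (h : Incidence X U) n →
                      Occurs (monotone n) (complement h) → Occurs (monotone n) h
monotone-complement h n = occurs-complement h opposite opposite eq
  where
  to : ∀ i j → toℕ i ≤ toℕ j → suc (toℕ (opposite j)) ≤ toℕ (opposite i)
  -- Since `j < n`, truncation does no harm and `suc (n ∸ suc j)` becomes `n ∸ j`.
  to i j i≤j rewrite Fin.opposite-prop i | Fin.opposite-prop j
    | sym (ℕ.+-∸-assoc 1 (Fin.toℕ<n j)) = ℕ.∸-monoʳ-≤ n i≤j
  from : ∀ (i : Fin (suc n)) (j : Fin n) →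
         suc (toℕ (opposite j)) ≤ toℕ (opposite i) → toℕ i ≤ toℕ j
  from i j le rewrite Fin.opposite-prop i | Fin.opposite-prop j
    | sym (ℕ.+-∸-assoc 1 (Fin.toℕ<n j)) = ℕ.∸-cancelʳ-≤ (s≤s⁻¹ (Fin.toℕ<n i)) le
  eq : ∀ i j → monotone n (opposite i) (opposite j) ≡ not (monotone n i j)
  eq i j with suc (toℕ j) ℕ.≤? toℕ i
  ... | yes j<i = ⌊⌋-false (_ ℕ.≤? _) (ℕ.<⇒≱ j<i ∘ from i j)
  ... | no  j≮i = ⌊⌋-true (_ ℕ.≤? _) (to i j (ℕ.≮⇒≥ j≮i))

-- The upper left corner is again monotone. This brings the sizes `suc k` and `suc l` down to their
-- minimum.
monotone-shrink : ∀ (h : Incidence X U) → m ≤ n → Occurs (monotone n) h → Occurs (monotone m) h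
monotone-shrink {m = m} {n = n} h m≤n (x , u , occ) =
  (λ i → x (inject≤ i (s≤s m≤n))) , (λ j → u (inject≤ j m≤n)) , λ i j → trans (occ _ _) (eq i j)
  where
  eq : ∀ i j → monotone n (inject≤ i (s≤s m≤n)) (inject≤ j m≤n) ≡ monotone m i j
  eq i j rewrite Fin.toℕ-inject≤ i (s≤s m≤n) | Fin.toℕ-inject≤ j m≤n = refl

-- Staircases and their extraction from a large family.

record Staircase {X : Set a} {U : Set b} (h : Incidence X U)
                 (xs : List X) (n : ℕ) : Set (a Level.⊔ b) where
  field
    set      : Fin (suc n) → X
    element  : Fin n → U
    set∈     : ∀ i → set i ∈ xs
    avoids   : ∀ i → h (set (inject₁ i)) (element i) ≡ false
    contains : ∀ i j → toℕ j < toℕ i → h (set i) (element j) ≡ true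

single : ∀ {h : Incidence X U} {x xs} → x ∈ xs → Staircase h xs 0
single {x = x} x∈xs = record
  { set      = λ _ → x
  ; element  = λ ()
  ; set∈     = λ _ → x∈xs
  ; avoids   = λ ()
  ; contains = λ _ ()
  }

-- Here `ys` is the part in which the construction goes on: all its sets contain `u`, so `x` can
-- precede any staircase drawn from it.
cons : ∀ {h : Incidence X U} {x u xs ys} → x ∈ xs → h x u ≡ false →
       (∀ {y} → y ∈ ys → y ∈ xs × h y u ≡ true) →
       Staircase h ys n → Staircase h xs (suc n)
cons {h = h} {x} {u} {xs} x∈xs hxu ys-true s = record
  { set      = x Vector.∷ set
  ; element  = u Vector.∷ element
  ; set∈     = λ where
      zero    → x∈xs
      (suc i) → proj₁ (ys-true (set∈ i))
  ; avoids   = λ where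
      zero    → hxu
      (suc i) → avoids i
  ; contains = λ where
      (suc i) zero    _         → proj₂ (ys-true (set∈ i))
      (suc i) (suc j) (s≤s j<i) → contains i j j<i
  }
  where open Staircase s

nCk-positive : ∀ p q → 1 ≤ (p + q) C p
nCk-positive zero    q = ℕ.≤-reflexive (sym (trans (nCk≡nC[n∸k] {0} {q} z≤n) (nCn≡1 q)))
nCk-positive (suc p) q = ℕ.≤-trans (nCk-positive p q)
  (ℕ.≤-trans (ℕ.m≤m+n _ _) (ℕ.≤-reflexive (nCk+nC[k+1]≡[n+1]C[k+1] (p + q) p)))

+-split-< : ∀ {x y z w} → x + y < z + w → x < z ⊎ y < w
+-split-< {x} {y} {z} {w} lt with x ℕ.<? z
... | yes x<z = inj₁ x<z
... | no  x≮z = inj₂ (ℕ.≰⇒> λ w≤y → ℕ.<⇒≱ lt (ℕ.+-mono-≤ (ℕ.≮⇒≥ x≮z) w≤y))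

module _ {X : Set a} {U : Set ℓ} (h : Incidence X U) where

  part : U → Bool → List X → List X
  part u b = filter (λ x → h x u Bool.≟ b)

  length-part : ∀ u xs → length (part u false xs) + length (part u true xs) ≡ length xs
  length-part u []       = refl
  length-part u (x ∷ xs) with h x u
  ... | false = cong suc (length-part u xs)
  ... | true  = trans (ℕ.+-suc _ _) (cong suc (length-part u xs))

  splitting : Separated h → ∀ xs → Unique xs → 1 < length xs →
              ∃[ u ] ∃[ x ] ∃[ y ] (x ∈ xs × h x u ≡ false × y ∈ xs × h y u ≡ true)
  splitting sep (x ∷ y ∷ xs) ((x≢y All.∷ _) ∷ _) _ with sep x y x≢y
  ... | u , hxu≢hyu with h x u in hxu | h y u in hyu
  ...   | false | false = contradiction refl hxu≢hyu
  ...   | false | true  = u , x , y , here refl , hxu , there (here refl) , hyu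
  ...   | true  | false = u , y , x , there (here refl) , hyu , here refl , hxu
  ...   | true  | true  = contradiction refl hxu≢hyu
  splitting _ (_ ∷ []) _ (s≤s ())

  -- A staircase for `complement h` consists of sets containing their own element. Pascal's rule
  -- leaves one part large enough: in the part avoiding `u`, `y` is put aside and `p` drops; in the
  -- part containing `u`, `x` is put aside and `q` drops.
  staircases : Separated h → ∀ p q xs → Unique xs → (p + q) C p < length xs →
               Staircase (complement h) xs (suc p) ⊎ Staircase h xs (suc q)
  -- The binomial coefficient is at least 1, so there are two sets to split.
  staircases sep p q xs xs! lt with splitting sep xs xs! (ℕ.≤-<-trans (nCk-positive p q) lt)
  -- One step is enough here: `y` is put aside and `x` alone is the remaining family.
  staircases sep zero q xs xs! lt | u , x , y , x∈ , hxu , y∈ , hyu =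
    inj₁ (cons y∈ (cong not hyu) (λ { (here refl) → x∈ , cong not hxu }) (single {xs = [ x ]} (here refl)))
  staircases sep (suc p) zero xs xs! lt | u , x , y , x∈ , hxu , y∈ , hyu =
    inj₂ (cons x∈ hxu (λ { (here refl) → y∈ , hyu }) (single {xs = [ y ]} (here refl)))
  staircases sep (suc p) (suc q) xs xs! lt | u , x , y , x∈ , hxu , y∈ , hyu =
    [ (λ lt₀ → Sum.map (cons y∈ (cong not hyu) in₀) (weaken in₀)
                 (staircases sep p (suc q) (part u false xs) (filter⁺ _ xs!) lt₀))
    , (λ lt₁ → Sum.map (weaken in₁) (cons x∈ hxu in₁)
                 (staircases sep (suc p) q (part u true xs) (filter⁺ _ xs!) lt₁))
    ]′ (+-split-< (subst₂ _<_ pascal (sym (length-part u xs)) lt))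
    where
    pascal : (suc p + suc q) C suc p ≡ (p + suc q) C p + (suc p + q) C suc p
    pascal = trans (sym (nCk+nC[k+1]≡[n+1]C[k+1] (p + suc q) p))
                   (cong (λ n → (p + suc q) C p + n C suc p) (ℕ.+-suc p q))
    in₀ : ∀ {y} → y ∈ part u false xs → y ∈ xs × complement h y u ≡ true
    in₀ y∈ with y∈xs , hyu ← ∈-filter⁻ _ y∈ = y∈xs , cong not hyu
    in₁ : ∀ {y} → y ∈ part u true xs → y ∈ xs × h y u ≡ true
    in₁ y∈ = ∈-filter⁻ _ y∈
    weaken : ∀ {g : Incidence X U} {ys n} {P : Pred X 0ℓ} → (∀ {y} → y ∈ ys → y ∈ xs × P y) →
             Staircase g ys n → Staircase g xs n
    weaken sub s = record
      { set = set ; element = element ; set∈ = λ i → proj₁ (sub (set∈ i))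
      ; avoids = avoids ; contains = contains }
      where open Staircase s

-- From staircases to matrices

-- The order is kept so that the staircase conditions and the colour of pairs `i < j` pass to the
-- selected rows and columns.
enumerate : ∀ (A : Subset n) → r ≤ ∣ A ∣ →
            ∃[ f ] ((∀ (i : Fin r) → f i Subset.∈ A) × (∀ i j → i Fin.< j → f i Fin.< f j))
enumerate {r = zero}  A             r≤ = (λ ()) , (λ ()) , λ ()
enumerate {r = suc r} (outside ∷ᵛ A) r≤ with f , f∈ , f-mono ← enumerate A r≤ =
  suc ∘ f , there ∘ f∈ , λ i j → s≤s ∘ f-mono i j
enumerate {r = suc r} (inside ∷ᵛ A) (s≤s r≤) with f , f∈ , f-mono ← enumerate A r≤ =
  zero Vector.∷ (suc ∘ f) ,
  (λ where
    zero    → here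
    (suc i) → there (f∈ i)) ,
  (λ where
    zero    (suc j) _         → s≤s z≤n
    (suc i) (suc j) (s≤s i<j) → s≤s (f-mono i j i<j))

module _ {h : Incidence X U} {xs : List X} (s : Staircase h xs n) where
  open Staircase s

  -- Vertex `i` stands for the `i`th set together with its element, so the colours of pairs `i < j`
  -- are the free incidences. The last set has no element of its own and gives no vertex.
  colouring : Colouring n
  colouring i j = h (set (inject₁ i)) (element j)

  monochromatic⇒triangular : ∀ {A : Subset n} {d} → r ≤ ∣ A ∣ → Monochromatic colouring d A →
                             ∃[ N ] (Triangular d N × Occurs {m = suc r} N h)
  monochromatic⇒triangular {r = r} {A = A} {d} r≤ mono with f , f∈ , f-mono ← enumerate A r≤ =
    N , t , sets , element ∘ f , λ _ _ → refl
    where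
    -- The `r` chosen vertices give only `r` rows; the last set of the staircase, which contains
    -- every element, supplies the remaining one.
    f̂ : Fin (suc r) → Fin (suc n)
    f̂ i with view i
    ... | ‵fromℕ      = fromℕ n
    ... | ‵inject₁ i′ = inject₁ (f i′)
    f̂-inject₁ : ∀ i → f̂ (inject₁ i) ≡ inject₁ (f i)
    f̂-inject₁ i rewrite view-inject₁ i = refl
    f<f̂ : ∀ i j → toℕ j < toℕ i → toℕ (f j) < toℕ (f̂ i)
    f<f̂ i j j<i with view i
    ... | ‵fromℕ      = subst (toℕ (f j) <_) (sym (Fin.toℕ-fromℕ n)) (Fin.toℕ<n (f j))
    ... | ‵inject₁ i′ = subst (toℕ (f j) <_) (sym (Fin.toℕ-inject₁ (f i′)))
                          (f-mono j i′ (subst (toℕ j <_) (Fin.toℕ-inject₁ i′) j<i))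
    sets : Fin (suc r) → _
    sets = set ∘ f̂
    N : Matrix (suc r) r
    N i j = h (sets i) (element (f j))
    t : Triangular d N
    t .diagonal i    rewrite f̂-inject₁ i = avoids (f i)
    t .below i j j<i = contains (f̂ i) (f j) (f<f̂ i j j<i)
    t .above i j i<j rewrite f̂-inject₁ i = mono (f i) (f j) (f∈ i) (f∈ j) (f-mono i j i<j)

  occurs-triangular : ∀ {d} {M : Matrix (suc r) r} {A : Subset n} → Triangular d M → r ≤ ∣ A ∣ →
                      Monochromatic colouring d A → Occurs M h
  occurs-triangular tM r≤ mono with N , tN , x , u , occ ← monochromatic⇒triangular r≤ mono =
    x , u , λ i j → trans (occ i j) (triangular-unique tN tM i j)

  ramsey-staircase : IsRamsey r n → Occurs (cosingleton r) h ⊎ Occurs (monotone r) h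
  ramsey-staircase {r = r} (_ , ram) with ram colouring
  ... | A , r≤ , inj₁ mono = inj₂ (occurs-triangular (monotone-triangular r) r≤ mono)
  ... | A , r≤ , inj₂ mono = inj₁ (occurs-triangular (cosingleton-triangular r) r≤ mono)

-- Unavoidable matrices and the binomial bound.

Unavoidable : ℕ → ℕ → Incidence X U → Set _
Unavoidable k l h =
  Occurs (singleton (suc k)) h ⊎
  Occurs (cosingleton (suc l)) h ⊎
  Occurs (monotone (suc k ⊓ suc l)) h

R-isRamsey : ∀ r → IsRamsey r (R r)
R-isRamsey r = proj₁ (proj₂ (ramsey r))

staircase-bound : ℕ → ℕ → ℕ
staircase-bound k l = (R (suc k) + R (suc l) ∸ 2) C (R (suc k) ∸ 1)

unavoidable : ∀ k l (h : Incidence (Fin m) U) → Separated h →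
              staircase-bound k l < m → Unavoidable k l h
unavoidable {m = m} k l h sep lt
  -- Ramsey numbers are positive. Written as `suc p` and `suc q`, they turn the bound into
  -- `(p + q) C p` and are exactly the staircase lengths obtained.
  with R (suc k) | R (suc l) | R-isRamsey (suc k) | R-isRamsey (suc l)
... | suc p | suc q | ramₖ | ramₗ =
  -- This staircase lives in the complement, where a cosingleton matrix is a singleton matrix of
  -- `h`.
  [ (λ s → Sum.map (cosingleton-complement h (suc k))
                   (inj₂ ∘ monotone-shrink h (ℕ.m⊓n≤m (suc k) (suc l)) ∘ monotone-complement h (suc k))
                   (ramsey-staircase s ramₖ))
  , (λ s → inj₂ (Sum.map₂ (monotone-shrink h (ℕ.m⊓n≤n (suc k) (suc l))) (ramsey-staircase s ramₗ)))
  ]′ (staircases h sep p q (allFin m) (allFin⁺ m)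
       (subst₂ _<_ (cong (λ n → (n ∸ 1) C p) (ℕ.+-suc p q))
         (sym (length-tabulate {n = m} (λ i → i))) lt))
... | zero  | _     | () , _ | _
... | suc p | zero  | _ | () , _

unavoidable-complement : ∀ k l (h : Incidence X U) →
                         Unavoidable k l (complement h) → Unavoidable l k h
unavoidable-complement k l h =
  [ inj₂ ∘ inj₁ ∘ singleton-complement h (suc k)
  , [ inj₁ ∘ cosingleton-complement h (suc l)
    , inj₂ ∘ inj₂ ∘ subst (λ n → Occurs (monotone n) h) (ℕ.⊓-comm (suc k) (suc l))
      ∘ monotone-complement h (suc k ⊓ suc l)
    ]′
  ]′

-- Passage between collections and incidences

-- The finite Boolean form of `Forces`, with exactly `s + 1` sets. Complementation acts directly on
-- it, so the symmetry in `k` and `l` is proved here.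
ForcesIncidence : ∀ a → ℕ → ℕ → ℕ → Set (lsuc a)
ForcesIncidence a k l s =
  (U : Set a) (h : Incidence (Fin (suc s)) U) → Separated h → Unavoidable k l h

forcesIncidence-sym : ∀ k l {s} → ForcesIncidence a k l s → ForcesIncidence a l k s
forcesIncidence-sym k l F U h sep = unavoidable-complement k l h (F U (complement h)
  λ x y x≢y → let u , hxu≢hyu = sep x y x≢y in u , hxu≢hyu ∘ not-injective)

-- The rows of `h`, up to extensional equality, form a collection. Each set found in it carries the
-- index of a row, from which the occurrence is read off.
forces⇒forcesIncidence : ∀ {k l s} → Forces a k l s → ForcesIncidence a k l s
forces⇒forcesIncidence {a = a} {s = s} F U h sep =
  Sum.map occurs (Sum.map occurs occurs) (F U ℋ (sets , (λ i → i , ≐-refl) , distinct))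
  where
  sets : Fin (suc s) → Pred U a
  sets i u = Lift a (h i u ≡ true)
  ℋ : Collection U
  ℋ A = ∃[ i ] A ≐ sets i
  distinct : Injective _≡_ _≐_ sets
  distinct {i} {j} (⊆ , ⊇) = decidable-stable (i Fin.≟ j) λ i≢j →
    let u , hiu≢hju = sep i j i≢j in
    hiu≢hju (⇔→≡ (mk⇔ (λ p → lower (⊆ (lift p))) (λ p → lower (⊇ (lift p)))))
  occurs : ∀ {m n} {N : Matrix m n} → FoundIn N ℋ → Occurs N h
  occurs (H , e , (H∈ , _) , _ , _ , N⇔) = proj₁ ∘ H∈ , e , λ α β →
    let ⊆ , ⊇ = proj₂ (H∈ α) ; N⇔αβ = N⇔ α β in
    ⇔→≡ (mk⇔ (λ p → Equivalence.from N⇔αβ (⊇ (lift p))) (λ p → lower (⊆ (Equivalence.to N⇔αβ p))))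

module _ (em : ExcludedMiddle (lsuc a)) where

  -- Excluded middle is assumed at the level of `Forces`; lifting brings it down to membership.
  decide : (P : Set a) → Dec P
  decide P = map′ lower lift (em {Lift (lsuc a) P})

  -- The `s + 1` chosen members become rows by deciding membership. Two rows without a separating
  -- element would be extensionally equal sets, against distinctness.
  forcesIncidence⇒forces : ∀ {k l s} → ForcesIncidence a k l s → Forces a k l s
  forcesIncidence⇒forces {k} {l} {s} F U ℋ (H , H∈ , H-inj) =
    Sum.map (found (singleton-discerning (suc k)))
      (Sum.map (found (triangular⇒discerning (cosingleton-triangular (suc l))))
               (found (triangular⇒discerning (monotone-triangular (suc k ⊓ suc l)))))
      (F U h sep)
    where
    h : Incidence (Fin (suc s)) U
    h i u = ⌊ decide (H i u) ⌋
    h⇔ : ∀ i u → h i u ≡ true ⇔ H i u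
    h⇔ i u = mk⇔ (⌊⌋≡true⇒ (decide (H i u))) (⌊⌋-true (decide (H i u)))
    ≐⇒≡ : ∀ {i j} → H i ≐ H j → ∀ u → h i u ≡ h j u
    ≐⇒≡ {i} {j} (⊆ , ⊇) u = ⌊⌋-⇔ (decide (H i u)) (decide (H j u)) (mk⇔ ⊆ ⊇)
    sep : Separated h
    sep i j i≢j with decide (∃[ u ] h i u ≢ h j u)
    ... | yes sep-ij = sep-ij
    ... | no  ∄u     = contradiction (H-inj
          ( (λ {u} Hiu → Equivalence.to (h⇔ j u) (trans (sym (h≡ u)) (Equivalence.from (h⇔ i u) Hiu)))
          , (λ {u} Hju → Equivalence.to (h⇔ i u) (trans (h≡ u) (Equivalence.from (h⇔ j u) Hju))))) i≢j
      where
      h≡ : ∀ u → h i u ≡ h j u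
      h≡ u = decidable-stable (h i u Bool.≟ h j u) λ ne → ∄u (u , ne)
    found : ∀ {m n} {N : Matrix m n} → Discerning N → Occurs N h → FoundIn N ℋ
    found {N = N} disc (x , u , occ) = H ∘ x , u ,
      (H∈ ∘ x , λ {i} {j} Hi≐Hj → row-injective disc λ k →
        trans (sym (occ i k)) (trans (≐⇒≡ Hi≐Hj (u k)) (occ j k))) ,
      (λ {i} {j} ui≡uj → column-injective disc λ k →
        trans (sym (occ k i)) (trans (cong (h (x k)) ui≡uj) (occ k j))) ,
      (λ j → let i , one = column-nonzero disc j in
        H (x i) , H∈ (x i) , Equivalence.to (h⇔ (x i) (u j)) (trans (occ i j) one)) ,
      λ i j → mk⇔ (Equivalence.to (h⇔ (x i) (u j)) ∘ trans (occ i j))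
                  (trans (sym (occ i j)) ∘ Equivalence.from (h⇔ (x i) (u j)))

  forces-sym : ∀ k l {s} → Forces a k l s → Forces a l k s
  forces-sym k l = forcesIncidence⇒forces ∘ forcesIncidence-sym k l ∘ forces⇒forcesIncidence

  forces-bound : ∀ k l → Forces a k l (staircase-bound k l)
  forces-bound k l = forcesIncidence⇒forces λ U h sep → unavoidable k l h sep ℕ.≤-refl

  -- Since `Forces` quantifies over all collections, excluded middle has to decide it at each
  -- smaller number.
  least : (P : Pred ℕ (lsuc a)) → ∀ n → P n → ∃[ n ] IsLeast P n
  least P = <-rec (λ n → P n → ∃[ n ] IsLeast P n) λ n rec Pn → step n rec Pn
    where
    step : ∀ n → (∀ {m} → m < n → P m → ∃[ n ] IsLeast P n) → P n → ∃[ n ] IsLeast P n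
    step n rec Pn with ℕ.anyUpTo? (λ m → em {P m}) n
    ... | yes (m , m<n , Pm) = rec m<n Pm
    ... | no  ∄m<n           = n , Pn , λ m Pm → ℕ.≮⇒≥ λ m<n → ∄m<n (m , m<n , Pm)

theorem2 : ∀ {a} → ExcludedMiddle (lsuc a) →
    Σ[ S ∈ (ℕ → ℕ → ℕ) ]
    (∀ k l → IsLeast (Forces a k l) (S k l)) ×
    (∀ k l → S k l ≡ S l k ×
    S k l ≤ (R (suc k) + R (suc l) ∸ 2) C (R (suc k) ∸ 1))
theorem2 {a} em = S , S-least , λ k l →
  ℕ.≤-antisym (S-sym k l) (S-sym l k) , proj₂ (S-least k l) _ (forces-bound em k l)
  where
  S′ : ∀ k l → ∃[ s ] IsLeast (Forces a k l) s
  S′ k l = least em (Forces a k l) _ (forces-bound em k l)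
  S : ℕ → ℕ → ℕ
  S k l = proj₁ (S′ k l)
  S-least : ∀ k l → IsLeast (Forces a k l) (S k l)
  S-least k l = proj₂ (S′ k l)
  S-sym : ∀ k l → S k l ≤ S l k
  -- By symmetry `S l k` also forces for `k` and `l`, so minimality of `S k l` applies.
  S-sym k l = proj₂ (S-least k l) _ (forces-sym em l k (proj₁ (S-least l k)))
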